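{- There exist infinitely many block-transitive, $3$-grid-imprimitive $2$-designs, and at least one block-transitive, $4$-grid-imprimitive $2$-design.
   Context: A $2$-design, or $2$-$(v,k,\lambda)$ design, is an incidence structure with a finite set $\mathcal{P}$ of $v$ points and a set of blocks, each a $k$-subset of $\mathcal{P}$, such that every pair of distinct points is contained in exactly $\lambda$ blocks, for a constant $\lambda$. A permutation group $H$ on a finite set $\mathcal{P}$ is $s$-grid-imprimitive, where $s\ge2$, if $\mathcal{P}$ can be identified with a Cartesian product $\mathcal{E}_1\times\cdots\times\mathcal{E}_s$ with $|\mathcal{E}_i|>1$ for all $i$, in such a way that $H\le \mathrm{Sym}(\mathcal{E}_1)\times\cdots\times\mathrm{Sym}(\mathcal{E}_s)$ acting coordinatewise, $(\delta_1,\dots,\delta_s)^{(g_1,\dots,g_s)}=(\delta_1^{g_1},\dots,\delta_s^{g_s})$. A $2$-design is called block-transitive, $s$-grid-imprimitive if it admits a group $H$ of automorphisms that is transitive on the set of blocks and whose action on points is $s$-grid-imprimitive. -}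

module Defs where

open import Level using (Level)
open import Data.Nat.Base using (ℕ; _≤_; _<_; suc)
open import Data.Fin.Base using (Fin)
open import Data.Fin.Permutation
  using (Permutation; Permutation′; _⟨$⟩ʳ_; _⟨$⟩ˡ_; _≈_; _∘ₚ_; flip; id)
open import Data.Fin.Subset using (Subset; ∣_∣; _∈_)
open import Data.Fin.Subset.Properties using (_∈?_)
open import Data.List.Base using (List; length; filter)
import Data.List.Membership.Propositional as List
open import Data.List.Relation.Unary.All using (All)
open import Data.List.Relation.Unary.Unique.Propositional using (Unique)
open import Data.Product.Base using (Σ; ∃; _×_)
open import Data.Vec.Base using (lookup; tabulate)
open import Function.Bundles using (_⇔_)
open import Function.Definitions using (Bijective; Injective)
open import Relation.Binary.PropositionalEquality.Core using (_≡_; _≢_)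
open import Relation.Nullary.Decidable using (_×-dec_)

-- The finite set of blocks is a duplicate-free list; no definition below
-- depends on its order.
record TwoDesign : Set where
  field
    v k lam  : ℕ
    blocks   : List (Subset v)
    distinct : Unique blocks
    uniform  : All (λ B → ∣ B ∣ ≡ k) blocks
    balanced : ∀ {x y : Fin v} → x ≢ y →
               length (filter (λ B → (x ∈? B) ×-dec (y ∈? B)) blocks) ≡ lam

  IsBlock : Subset v → Set
  IsBlock B = B List.∈ blocks

open TwoDesign public using (IsBlock)

-- Without such a condition the design with no blocks, the design whose only
-- block is the whole point set (k = v), and the design of all point
-- complements (k = v - 1) would count as examples for every grid.
record Nontrivial (D : TwoDesign) : Set where
  open TwoDesign D
  field
    0<lam : 0 < lam
    2<k   : 2 < k
    k<v-1 : suc k < v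

image : ∀ {m n} → Permutation m n → Subset m → Subset n
image π B = tabulate (λ y → lookup B (π ⟨$⟩ˡ y))

IsIsomorphism : (D E : TwoDesign) →
                Permutation (TwoDesign.v D) (TwoDesign.v E) → Set
IsIsomorphism D E π = ∀ B → IsBlock D B ⇔ IsBlock E (image π B)

IsAutomorphism : (D : TwoDesign) → Permutation′ (TwoDesign.v D) → Set
IsAutomorphism D = IsIsomorphism D D

infix 4 _≅_
_≅_ : TwoDesign → TwoDesign → Set
D ≅ E = ∃ (IsIsomorphism D E)

record PermutationGroup (n : ℕ) : Set₁ where
  field
    Member    : Permutation′ n → Set
    respects  : ∀ {g h} → g ≈ h → Member g → Member h
    id-closed : Member id
    ∘-closed  : ∀ {g h} → Member g → Member h → Member (g ∘ₚ h)
    ⁻¹-closed : ∀ {g} → Member g → Member (flip g)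

open PermutationGroup public using (Member)

-- `grid` identifies the points with the product of the sets Fin (e i);
-- tuples are functions on Fin s, compared coordinatewise.
record GridImprimitive (s : ℕ) {n : ℕ} (H : PermutationGroup n) : Set where
  field
    2≤s        : 2 ≤ s
    e          : Fin s → ℕ
    1<e        : ∀ i → 1 < e i
    grid       : Fin n → (i : Fin s) → Fin (e i)
    bijective  : Bijective _≡_ (λ δ ε → ∀ i → δ i ≡ ε i) grid
    coordinate : ∀ {h} → Member H h →
                 Σ ((i : Fin s) → Permutation′ (e i)) λ g →
                   ∀ p i → grid (h ⟨$⟩ʳ p) i ≡ g i ⟨$⟩ʳ grid p i

BlockTransitive : (D : TwoDesign) → PermutationGroup (TwoDesign.v D) → Set
BlockTransitive D H = ∀ {B C} → IsBlock D B → IsBlock D C →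
                      ∃ λ h → Member H h × image h B ≡ C

record BlockTransitiveGridImprimitive (s : ℕ) (D : TwoDesign) : Set₁ where
  field
    H               : PermutationGroup (TwoDesign.v D)
    automorphisms   : ∀ {h} → Member H h → IsAutomorphism D h
    blockTransitive : BlockTransitive D H
    gridImprimitive : GridImprimitive s H

-- Infinitely many designs up to isomorphism: a sequence of pairwise
-- non-isomorphic ones.
InfinitelyMany : ∀ {ℓ : Level} → (TwoDesign → Set ℓ) → Set ℓ
InfinitelyMany P =
  Σ (ℕ → TwoDesign) λ D → Injective _≡_ _≅_ D × (∀ n → P (D n))

{-# OPTIONS --safe #-}

-- The translates of the support of the quadratic form
-- Q x = x₁x₂ + x₃x₄ + ⋯ on the vector space F₂²ᵐ form a symmetric 2-design,
-- because Q is bent: Q x + Q (x + a) is balanced for every a ≠ 0.  The group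
-- of all translations permutes the blocks transitively, and it acts
-- coordinatewise for every splitting of the 2m coordinates into s nonempty
-- parts.

module Submission where

open import Defs
open import Data.Bool.Base using (Bool; true; false; not; _∧_; _xor_; if_then_else_)
open import Data.Bool.Properties
  using (_≟_; xor-assoc; xor-comm; xor-same; ∧-idem)
open import Data.Fin.Base using (Fin; zero; suc; combine; remQuot; _↑ˡ_; _↑ʳ_)
open import Data.Fin.Permutation
  using (Permutation′; _⟨$⟩ʳ_; _⟨$⟩ˡ_; permutation; flip; ↔⇒≡; inverseˡ; inverseʳ)
open import Data.Fin.Properties using (2↔Bool; combine-remQuot; remQuot-combine)
open import Data.Fin.Subset using (Subset; ∣_∣)
open import Data.Fin.Subset.Properties using (_∈?_)
import Data.List.Base as List
open import Data.List.Membership.Propositional.Properties using (∈-tabulate⁺; ∈-tabulate⁻)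
import Data.List.Relation.Unary.All.Properties as All
import Data.List.Relation.Unary.Unique.Propositional.Properties as Unique
open import Data.Nat.Base using (ℕ; zero; suc; _+_; _*_; _^_; _<_; s≤s; z<s)
open import Data.Nat.Properties as ℕ using ()
open import Data.Nat.Solver using (module +-*-Solver)
open import Data.Product.Base using (∃; _×_; _,_; proj₁; proj₂)
open import Data.Vec.Base using (Vec; []; _∷_; head; lookup; replicate; tabulate; zipWith)
open import Data.Vec.Properties
  using (≡-dec; ∷-injectiveˡ; lookup∘tabulate; tabulate∘lookup;
         tabulate-cong; zipWith-assoc; zipWith-comm; zipWith-identityˡ)
open import Function.Base using (_∘_)
open import Function.Bundles using (Inverse; mk⇔)
open import Relation.Binary.Definitions using (tri<; tri≈; tri>)
open import Relation.Binary.PropositionalEquality.Core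
  using (_≡_; _≢_; refl; sym; trans; cong; cong₂; subst)
open import Relation.Binary.PropositionalEquality.Properties using (module ≡-Reasoning)
open import Relation.Nullary.Decidable
  using (Dec; yes; no; does; map′; toWitness; ¬?; _×-dec_; _→-dec_)
open import Relation.Nullary.Negation using (¬_; contradiction)

open +-*-Solver using (solve; _:+_; _:*_; _:=_; con)

-- The elementary abelian group F₂ⁿ

infixr 6 _⊕_
_⊕_ : ∀ {n} → Vec Bool n → Vec Bool n → Vec Bool n
_⊕_ = zipWith _xor_

⊕-comm : ∀ {n} (x y : Vec Bool n) → x ⊕ y ≡ y ⊕ x
⊕-comm = zipWith-comm xor-comm

⊕-assoc : ∀ {n} (x y z : Vec Bool n) → (x ⊕ y) ⊕ z ≡ x ⊕ (y ⊕ z)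
⊕-assoc = zipWith-assoc xor-assoc

⊕-identityˡ : ∀ {n} (x : Vec Bool n) → replicate n false ⊕ x ≡ x
⊕-identityˡ = zipWith-identityˡ (λ _ → refl)

⊕-cancelˡ : ∀ {n} (x y : Vec Bool n) → x ⊕ (x ⊕ y) ≡ y
⊕-cancelˡ []      []      = refl
⊕-cancelˡ (a ∷ x) (b ∷ y) = cong₂ _∷_
  (trans (sym (xor-assoc a a b)) (cong (_xor b) (xor-same a)))
  (⊕-cancelˡ x y)

-- Counting in F₂ⁿ

bit : Bool → ℕ
bit b = if b then 1 else 0

count : ∀ {n} → (Vec Bool n → Bool) → ℕ
count {zero}  f = bit (f [])
count {suc n} f = count (f ∘ (false ∷_)) + count (f ∘ (true ∷_))

count-cong : ∀ {n} {f g : Vec Bool n → Bool} → (∀ x → f x ≡ g x) → count f ≡ count g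
count-cong {zero}  f≗g = cong bit (f≗g [])
count-cong {suc n} f≗g = cong₂ _+_ (count-cong (f≗g ∘ (false ∷_))) (count-cong (f≗g ∘ (true ∷_)))

Σ₄ : (Bool → Bool → ℕ) → ℕ
Σ₄ g = (g false false + g false true) + (g true false + g true true)

Σ₄-cong : ∀ {f g} → (∀ a b → f a b ≡ g a b) → Σ₄ f ≡ Σ₄ g
Σ₄-cong f≗g = cong₂ _+_ (cong₂ _+_ (f≗g _ _) (f≗g _ _)) (cong₂ _+_ (f≗g _ _) (f≗g _ _))

Σ₄-linear : ∀ f g k w → Σ₄ (λ a b → f a b * k + g a b * w) ≡ Σ₄ f * k + Σ₄ g * w
Σ₄-linear f g = solve 10
  (λ f₁ f₂ f₃ f₄ g₁ g₂ g₃ g₄ k w →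
    ((f₁ :* k :+ g₁ :* w) :+ (f₂ :* k :+ g₂ :* w)) :+
    ((f₃ :* k :+ g₃ :* w) :+ (f₄ :* k :+ g₄ :* w))
    := ((f₁ :+ f₂) :+ (f₃ :+ f₄)) :* k :+ ((g₁ :+ g₂) :+ (g₃ :+ g₄)) :* w)
  refl
  (f false false) (f false true) (f true false) (f true true)
  (g false false) (g false true) (g true false) (g true true)

-- The bent function

Q : ∀ m → Vec Bool (m * 2) → Bool
Q zero    []          = false
Q (suc m) (a ∷ b ∷ x) = (a ∧ b) xor Q m x

-- Allowing both values of s and t at once is what makes the recursion close.
corr : ∀ m → (x y : Vec Bool (m * 2)) (s t : Bool) → ℕ
corr m x y s t = count (λ z → (s xor Q m (x ⊕ z)) ∧ (t xor Q m (y ⊕ z)))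

-- The two leading bits enter `Q` only through the added bit `(x₁ xor a) ∧ (x₂ xor b)`, which
-- associativity of `xor` moves into the constant `s`; likewise for `y` and `t`. What remains is a
-- correlation of the tails.
corr-∷ : ∀ m x₁ x₂ x y₁ y₂ y s t →
         corr (suc m) (x₁ ∷ x₂ ∷ x) (y₁ ∷ y₂ ∷ y) s t ≡
         Σ₄ (λ a b → corr m x y (s xor ((x₁ xor a) ∧ (x₂ xor b)))
                                (t xor ((y₁ xor a) ∧ (y₂ xor b))))
corr-∷ m x₁ x₂ x y₁ y₂ y s t = Σ₄-cong λ a b → count-cong λ z → sym (cong₂ _∧_
  (xor-assoc s ((x₁ xor a) ∧ (x₂ xor b)) (Q m (x ⊕ z)))
  (xor-assoc t ((y₁ xor a) ∧ (y₂ xor b)) (Q m (y ⊕ z))))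

-- Makes identities in finitely many bits decidable, so that the tables below are verified by
-- evaluation through `toWitness`.
∀Bool? : ∀ {P : Bool → Set} → (∀ b → Dec (P b)) → Dec (∀ b → P b)
∀Bool? {P} P? = map′ to (λ p → p false , p true) (P? false ×-dec P? true)
  where
  to : P false × P true → ∀ b → P b
  to (p , _) false = p
  to (_ , p) true  = p

-- This sum and the next are the coefficients in the induction step of `corr-same`. Adding the same
-- `q` to both constants leaves `s xor t` unchanged in all four terms.
Σ₄-agree-same : ∀ x₁ x₂ s t →
  Σ₄ (λ a b → let q = (x₁ xor a) ∧ (x₂ xor b) in bit (not ((s xor q) xor (t xor q))))
  ≡ 4 * bit (not (s xor t))
Σ₄-agree-same = toWitness {a? = ∀Bool? λ x₁ → ∀Bool? λ x₂ → ∀Bool? λ s → ∀Bool? λ t → _ ℕ.≟ _} _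

-- As `a` and `b` vary, `q` is `true` exactly once. If `s` and `t` agree, the conjunction therefore
-- holds three times when they are `true` and once when they are `false`; if they differ, it never
-- holds.
Σ₄-both-same : ∀ x₁ x₂ s t →
  Σ₄ (λ a b → let q = (x₁ xor a) ∧ (x₂ xor b) in bit ((s xor q) ∧ (t xor q)))
  ≡ bit (not (s xor t)) + 2 * bit (s ∧ t)
Σ₄-both-same = toWitness {a? = ∀Bool? λ x₁ → ∀Bool? λ x₂ → ∀Bool? λ s → ∀Bool? λ t → _ ℕ.≟ _} _

-- The two products are the indicators of two distinct points of F₂², so they differ at exactly two
-- of the four pairs `a`, `b`. This is the balance property that makes `Q` bent.
Σ₄-agree-different : ∀ x₁ x₂ y₁ y₂ → ¬ (x₁ ≡ y₁ × x₂ ≡ y₂) → ∀ s t →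
  Σ₄ (λ a b → bit (not ((s xor ((x₁ xor a) ∧ (x₂ xor b))) xor
                        (t xor ((y₁ xor a) ∧ (y₂ xor b))))))
  ≡ 2
Σ₄-agree-different = toWitness {a? = ∀Bool? λ x₁ → ∀Bool? λ x₂ → ∀Bool? λ y₁ → ∀Bool? λ y₂ →
  ¬? ((x₁ ≟ y₁) ×-dec (x₂ ≟ y₂)) →-dec ∀Bool? λ s → ∀Bool? λ t → _ ℕ.≟ _} _

-- The two indicators are never `true` together, each is `true` alone once, and both are `false`
-- twice. These are the counts when none, one or both of `s` and `t` are `true`.
Σ₄-both-different : ∀ x₁ x₂ y₁ y₂ → ¬ (x₁ ≡ y₁ × x₂ ≡ y₂) → ∀ s t →
  Σ₄ (λ a b → bit ((s xor ((x₁ xor a) ∧ (x₂ xor b))) ∧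
                   (t xor ((y₁ xor a) ∧ (y₂ xor b)))))
  ≡ bit s + bit t
Σ₄-both-different = toWitness {a? = ∀Bool? λ x₁ → ∀Bool? λ x₂ → ∀Bool? λ y₁ → ∀Bool? λ y₂ →
  ¬? ((x₁ ≟ y₁) ×-dec (x₂ ≟ y₂)) →-dec ∀Bool? λ s → ∀Bool? λ t → _ ℕ.≟ _} _

-- Each product is `true` once in four, so a constant `true` yields three ones and a constant
-- `false` yields one.
Σ₄-bits : ∀ x₁ x₂ y₁ y₂ s t →
  Σ₄ (λ a b → bit (s xor ((x₁ xor a) ∧ (x₂ xor b))) + bit (t xor ((y₁ xor a) ∧ (y₂ xor b))))
  ≡ (1 + 2 * bit s) + (1 + 2 * bit t)
Σ₄-bits = toWitness {a? = ∀Bool? λ x₁ → ∀Bool? λ x₂ → ∀Bool? λ y₁ → ∀Bool? λ y₂ →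
  ∀Bool? λ s → ∀Bool? λ t → _ ℕ.≟ _} _

-- In closed form (4ᵐ ∸ 2ᵐ) / 2.
weight : ℕ → ℕ
weight zero    = 0
weight (suc m) = 4 * weight m + 2 ^ m

-- With `s` and `t` both `false` this counts the ones of `Q`, with both `true` its zeros, which are
-- `2 ^ m` more; unequal constants give complementary conditions. Writing the cases as one linear
-- form in `weight m` and `2 ^ m` lets `Σ₄-linear` carry the induction.
corr-same : ∀ m x s t →
            corr m x x s t ≡ bit (not (s xor t)) * weight m + bit (s ∧ t) * 2 ^ m
corr-same zero [] false false = refl
corr-same zero [] false true  = refl
corr-same zero [] true  false = refl
corr-same zero [] true  true  = refl
corr-same (suc m) (x₁ ∷ x₂ ∷ x) s t = begin
  corr (suc m) (x₁ ∷ x₂ ∷ x) (x₁ ∷ x₂ ∷ x) s t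
    ≡⟨ corr-∷ m x₁ x₂ x x₁ x₂ x s t ⟩
  Σ₄ (λ a b → corr m x x (s xor q a b) (t xor q a b))
    ≡⟨ Σ₄-cong (λ a b → corr-same m x (s xor q a b) (t xor q a b)) ⟩
  Σ₄ (λ a b → agree a b * weight m + both a b * 2 ^ m)
    ≡⟨ Σ₄-linear agree both (weight m) (2 ^ m) ⟩
  Σ₄ agree * weight m + Σ₄ both * 2 ^ m
    ≡⟨ cong₂ (λ α β → α * weight m + β * 2 ^ m)
         (Σ₄-agree-same x₁ x₂ s t) (Σ₄-both-same x₁ x₂ s t) ⟩
  4 * bit (not (s xor t)) * weight m + (bit (not (s xor t)) + 2 * bit (s ∧ t)) * 2 ^ m
    ≡⟨ solve 4 (λ α β k w → con 4 :* α :* k :+ (α :+ con 2 :* β) :* w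
                         := α :* (con 4 :* k :+ w) :+ β :* (con 2 :* w))
         refl (bit (not (s xor t))) (bit (s ∧ t)) (weight m) (2 ^ m) ⟩
  bit (not (s xor t)) * weight (suc m) + bit (s ∧ t) * 2 ^ suc m ∎
  where
  open ≡-Reasoning
  q     = λ a b → (x₁ xor a) ∧ (x₂ xor b)
  agree = λ a b → bit (not ((s xor q a b) xor (t xor q a b)))
  both  = λ a b → bit ((s xor q a b) ∧ (t xor q a b))

-- If the tails agree, the heads differ and `corr-same` on the tails suffices. If the tails differ,
-- the formula holds for them by induction, whatever the heads are. The value does not depend on `x`
-- and `y`, and for `s` and `t` both `false` it is the λ of the design.
corr-different : ∀ m {x y} → x ≢ y → ∀ s t →
                 corr (suc m) x y s t ≡ 2 * weight m + (bit s + bit t) * 2 ^ m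
corr-different m {x₁ ∷ x₂ ∷ x} {y₁ ∷ y₂ ∷ y} x≢y s t with ≡-dec _≟_ x y
... | yes refl = begin
  corr (suc m) (x₁ ∷ x₂ ∷ x) (y₁ ∷ y₂ ∷ x) s t
    ≡⟨ corr-∷ m x₁ x₂ x y₁ y₂ x s t ⟩
  Σ₄ (λ a b → corr m x x (s xor q a b) (t xor r a b))
    ≡⟨ Σ₄-cong (λ a b → corr-same m x (s xor q a b) (t xor r a b)) ⟩
  Σ₄ (λ a b → agree a b * weight m + both a b * 2 ^ m)
    ≡⟨ Σ₄-linear agree both (weight m) (2 ^ m) ⟩
  Σ₄ agree * weight m + Σ₄ both * 2 ^ m
    ≡⟨ cong₂ (λ α β → α * weight m + β * 2 ^ m)
         (Σ₄-agree-different x₁ x₂ y₁ y₂ heads s t) (Σ₄-both-different x₁ x₂ y₁ y₂ heads s t) ⟩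
  2 * weight m + (bit s + bit t) * 2 ^ m ∎
  where
  open ≡-Reasoning
  q     = λ a b → (x₁ xor a) ∧ (x₂ xor b)
  r     = λ a b → (y₁ xor a) ∧ (y₂ xor b)
  agree = λ a b → bit (not ((s xor q a b) xor (t xor r a b)))
  both  = λ a b → bit ((s xor q a b) ∧ (t xor r a b))
  heads : ¬ (x₁ ≡ y₁ × x₂ ≡ y₂)
  heads (refl , refl) = x≢y refl
corr-different zero {_ ∷ _ ∷ []} {_ ∷ _ ∷ []} _ s t | no []≢[] = contradiction refl []≢[]
corr-different (suc m) {x₁ ∷ x₂ ∷ x} {y₁ ∷ y₂ ∷ y} _ s t | no tails = begin
  corr (suc (suc m)) (x₁ ∷ x₂ ∷ x) (y₁ ∷ y₂ ∷ y) s t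
    ≡⟨ corr-∷ (suc m) x₁ x₂ x y₁ y₂ y s t ⟩
  Σ₄ (λ a b → corr (suc m) x y (s xor q a b) (t xor r a b))
    ≡⟨ Σ₄-cong (λ a b → corr-different m tails (s xor q a b) (t xor r a b)) ⟩
  Σ₄ (λ a b → 2 * weight m + bits a b * 2 ^ m)
    ≡⟨ Σ₄-linear (λ _ _ → 2) bits (weight m) (2 ^ m) ⟩
  8 * weight m + Σ₄ bits * 2 ^ m
    ≡⟨ cong (λ β → 8 * weight m + β * 2 ^ m) (Σ₄-bits x₁ x₂ y₁ y₂ s t) ⟩
  8 * weight m + ((1 + 2 * bit s) + (1 + 2 * bit t)) * 2 ^ m
    ≡⟨ solve 4 (λ σ τ k w →
           con 8 :* k :+ ((con 1 :+ con 2 :* σ) :+ (con 1 :+ con 2 :* τ)) :* w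
           := con 2 :* (con 4 :* k :+ w) :+ (σ :+ τ) :* (con 2 :* w))
         refl (bit s) (bit t) (weight m) (2 ^ m) ⟩
  2 * weight (suc m) + (bit s + bit t) * 2 ^ suc m ∎
  where
  open ≡-Reasoning
  q    = λ a b → (x₁ xor a) ∧ (x₂ xor b)
  r    = λ a b → (y₁ xor a) ∧ (y₂ xor b)
  bits = λ a b → bit (s xor q a b) + bit (t xor r a b)

-- Numbering the vectors

encode : ∀ {n} → Vec Bool n → Fin (2 ^ n)
encode []      = zero
encode (b ∷ x) = combine (Inverse.from 2↔Bool b) (encode x)

decode : ∀ n → Fin (2 ^ n) → Vec Bool n
decode zero    _ = []
decode (suc n) i = Inverse.to 2↔Bool (proj₁ qr) ∷ decode n (proj₂ qr)
  where qr = remQuot {2} (2 ^ n) i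

decode-combine : ∀ n b i → decode (suc n) (combine (Inverse.from 2↔Bool b) i) ≡ b ∷ decode n i
decode-combine n b i = trans
  (cong (λ qr → Inverse.to 2↔Bool (proj₁ qr) ∷ decode n (proj₂ qr))
        (remQuot-combine (Inverse.from 2↔Bool b) i))
  (cong (_∷ decode n i) (Inverse.strictlyInverseˡ 2↔Bool b))

decode-encode : ∀ {n} (x : Vec Bool n) → decode n (encode x) ≡ x
decode-encode []      = refl
decode-encode (b ∷ x) = trans (decode-combine _ b (encode x)) (cong (b ∷_) (decode-encode x))

encode-decode : ∀ n i → encode (decode n i) ≡ i
encode-decode zero    zero = refl
encode-decode (suc n) i    = trans
  (cong₂ combine (Inverse.strictlyInverseʳ 2↔Bool (proj₁ qr)) (encode-decode n (proj₂ qr)))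
  (combine-remQuot {2} (2 ^ n) i)
  where qr = remQuot {2} (2 ^ n) i

encode-injective : ∀ {n} {x y : Vec Bool n} → encode x ≡ encode y → x ≡ y
encode-injective {x = x} {y} eq =
  trans (sym (decode-encode x)) (trans (cong (decode _) eq) (decode-encode y))

decode-injective : ∀ n {i j} → decode n i ≡ decode n j → i ≡ j
decode-injective n {i} {j} eq =
  trans (sym (encode-decode n i)) (trans (cong encode eq) (encode-decode n j))

-- Cardinalities of subsets as counts over vectors

∣tabulate∣-+ : ∀ m {n} (f : Fin (m + n) → Bool) →
               ∣ tabulate f ∣ ≡ ∣ tabulate (f ∘ (_↑ˡ n)) ∣ + ∣ tabulate (f ∘ (m ↑ʳ_)) ∣
∣tabulate∣-+ zero    f = refl
∣tabulate∣-+ (suc m) f with f zero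
... | true  = cong suc (∣tabulate∣-+ m (f ∘ suc))
... | false = ∣tabulate∣-+ m (f ∘ suc)

-- The leading bit decides between the lower and the upper half of the indices, which is the
-- recursion of `count`.
∣tabulate∣-decode : ∀ n (f : Vec Bool n → Bool) → ∣ tabulate (f ∘ decode n) ∣ ≡ count f
∣tabulate∣-decode zero f with f []
... | true  = refl
... | false = refl
∣tabulate∣-decode (suc n) f = begin
  ∣ tabulate g ∣
    ≡⟨ ∣tabulate∣-+ (2 ^ n) g ⟩
  ∣ tabulate (g ∘ lower) ∣ + ∣ tabulate (g ∘ (2 ^ n ↑ʳ_)) ∣
    -- `2 ^ suc n` unfolds to `2 ^ n + (2 ^ n + 0)`, so the upper half is followed by an empty third
    -- part.
    ≡⟨ cong (∣ tabulate (g ∘ lower) ∣ +_)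
         (trans (∣tabulate∣-+ (2 ^ n) (g ∘ (2 ^ n ↑ʳ_)))
                (ℕ.+-identityʳ ∣ tabulate (g ∘ upper) ∣)) ⟩
  ∣ tabulate (g ∘ lower) ∣ + ∣ tabulate (g ∘ upper) ∣
    ≡⟨ cong₂ (λ p q → ∣ p ∣ + ∣ q ∣)
         (tabulate-cong (λ i → cong f (decode-combine n false i)))
         (tabulate-cong (λ i → cong f (decode-combine n true i))) ⟩
  ∣ tabulate (f ∘ (false ∷_) ∘ decode n) ∣ + ∣ tabulate (f ∘ (true ∷_) ∘ decode n) ∣
    ≡⟨ cong₂ _+_ (∣tabulate∣-decode n (f ∘ (false ∷_))) (∣tabulate∣-decode n (f ∘ (true ∷_))) ⟩
  count f ∎
  where
  open ≡-Reasoning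
  g : Fin (2 ^ suc n) → Bool
  g = f ∘ decode (suc n)
  lower upper : Fin (2 ^ n) → Fin (2 ^ suc n)
  lower = combine {2} zero
  upper = combine {2} (suc zero)

does-∈? : ∀ {n} (x : Fin n) (p : Subset n) → does (x ∈? p) ≡ lookup p x
does-∈? zero    (true ∷ p)  = refl
does-∈? zero    (false ∷ p) = refl
does-∈? (suc x) (_ ∷ p)     = does-∈? x p

length-filter-tabulate : ∀ {A : Set} {P : A → Set} (P? : ∀ a → Dec (P a)) {n} (f : Fin n → A) →
  List.length (List.filter P? (List.tabulate f)) ≡ ∣ tabulate (does ∘ P? ∘ f) ∣
length-filter-tabulate P? {zero}  f = refl
length-filter-tabulate P? {suc n} f with does (P? (f zero))
... | true  = cong suc (length-filter-tabulate P? (f ∘ suc))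
... | false = length-filter-tabulate P? (f ∘ suc)

-- The designs

block : ∀ m → Vec Bool (m * 2) → Subset (2 ^ (m * 2))
block m b = tabulate (λ x → Q m (b ⊕ decode (m * 2) x))

lookup-block : ∀ m b x → lookup (block m b) x ≡ Q m (b ⊕ decode (m * 2) x)
lookup-block m b = lookup∘tabulate _

-- By idempotence of `∧` the size is a correlation of `Q` with itself at equal shifts.
∣block∣ : ∀ m b → ∣ block m b ∣ ≡ weight m
∣block∣ m b = begin
  ∣ block m b ∣                             ≡⟨ ∣tabulate∣-decode (m * 2) (λ z → Q m (b ⊕ z)) ⟩
  count (λ z → Q m (b ⊕ z))                 ≡⟨ count-cong (λ z → sym (∧-idem (Q m (b ⊕ z)))) ⟩
  corr m b b false false                    ≡⟨ corr-same m b false false ⟩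
  1 * weight m + 0                          ≡⟨ ℕ.+-identityʳ _ ⟩
  1 * weight m                              ≡⟨ ℕ.*-identityˡ _ ⟩
  weight m                                  ∎
  where open ≡-Reasoning

-- The constants `false` and `true` make `corr` count the points of the first block outside the
-- second. Equal blocks give 0, whereas `corr-different` gives at least `2 ^ m` for distinct shifts.
block-injective : ∀ m {b c} → block (suc m) b ≡ block (suc m) c → b ≡ c
block-injective m {b} {c} eq with ≡-dec _≟_ b c
... | yes b≡c = b≡c
... | no  b≢c = contradiction (begin
  2 * weight m + (0 + 1) * 2 ^ m  ≡⟨ corr-different m b≢c false true ⟨
  corr (suc m) b c false true     ≡⟨ count-cong (λ z → cong (λ q → Q (suc m) (b ⊕ z) ∧ not q) (sym (Q-agree z))) ⟩
  corr (suc m) b b false true     ≡⟨ corr-same (suc m) b false true ⟩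
  0                               ∎)
  (ℕ.>⇒≢ (ℕ.<-≤-trans (ℕ.m^n>0 2 m)
    (ℕ.≤-trans (ℕ.≤-reflexive (sym (ℕ.*-identityˡ _))) (ℕ.m≤n+m _ (2 * weight m)))))
  where
  open ≡-Reasoning
  Q-agree : ∀ z → Q (suc m) (b ⊕ z) ≡ Q (suc m) (c ⊕ z)
  Q-agree z = begin
    Q (suc m) (b ⊕ z)                     ≡⟨ cong (λ y → Q (suc m) (b ⊕ y)) (decode-encode z) ⟨
    Q (suc m) (b ⊕ decode _ (encode z))   ≡⟨ lookup-block (suc m) b (encode z) ⟨
    lookup (block (suc m) b) (encode z)   ≡⟨ cong (λ B → lookup B (encode z)) eq ⟩
    lookup (block (suc m) c) (encode z)   ≡⟨ lookup-block (suc m) c (encode z) ⟩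
    Q (suc m) (c ⊕ decode _ (encode z))   ≡⟨ cong (λ y → Q (suc m) (c ⊕ y)) (decode-encode z) ⟩
    Q (suc m) (c ⊕ z)                     ∎

-- The index is shifted: `design m` lives on F₂²ᵐ⁺². With q = 2ᵐ its parameters are v = 4q², k =
-- q(2q - 1) and λ = q(q - 1).
design : ℕ → TwoDesign
design m = record
  { v        = 2 ^ n
  ; k        = weight (suc m)
  ; lam      = 2 * weight m
  ; blocks   = List.tabulate blockAt
  ; distinct = Unique.tabulate⁺ (decode-injective n ∘ block-injective m)
  ; uniform  = All.tabulate⁺ (∣block∣ (suc m) ∘ decode n)
  ; balanced = λ {x} {y} x≢y → begin
      List.length (List.filter (λ B → (x ∈? B) ×-dec (y ∈? B)) (List.tabulate blockAt))
        ≡⟨ length-filter-tabulate (λ B → (x ∈? B) ×-dec (y ∈? B)) blockAt ⟩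
      ∣ tabulate (λ i → does (x ∈? blockAt i) ∧ does (y ∈? blockAt i)) ∣
        ≡⟨ cong ∣_∣ (tabulate-cong λ i → cong₂ _∧_ (incident x i) (incident y i)) ⟩
      ∣ tabulate (λ i → Q (suc m) (decode n x ⊕ decode n i) ∧ Q (suc m) (decode n y ⊕ decode n i)) ∣
        ≡⟨ ∣tabulate∣-decode n (λ z → Q (suc m) (decode n x ⊕ z) ∧ Q (suc m) (decode n y ⊕ z)) ⟩
      corr (suc m) (decode n x) (decode n y) false false
        ≡⟨ corr-different m (x≢y ∘ decode-injective n) false false ⟩
      2 * weight m + 0
        ≡⟨ ℕ.+-identityʳ _ ⟩
      2 * weight m ∎
  }
  where
  open ≡-Reasoning
  n = suc m * 2
  blockAt : Fin (2 ^ n) → Subset (2 ^ n)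
  blockAt = block (suc m) ∘ decode n
  incident : ∀ x i → does (x ∈? blockAt i) ≡ Q (suc m) (decode n x ⊕ decode n i)
  incident x i = begin
    does (x ∈? blockAt i)                    ≡⟨ does-∈? x (blockAt i) ⟩
    lookup (blockAt i) x                     ≡⟨ lookup-block (suc m) (decode n i) x ⟩
    -- The incidence matrix is symmetric, so the blocks through two points are counted like the
    -- points common to two blocks.
    Q (suc m) (decode n i ⊕ decode n x)      ≡⟨ cong (Q (suc m)) (⊕-comm (decode n i) (decode n x)) ⟩
    Q (suc m) (decode n x ⊕ decode n i)      ∎

isBlock : ∀ m b → IsBlock (design m) (block (suc m) b)
isBlock m b = subst (IsBlock (design m)) (cong (block (suc m)) (decode-encode b))
  (∈-tabulate⁺ (encode b))

isBlock⁻ : ∀ m {B} → IsBlock (design m) B → ∃ λ b → B ≡ block (suc m) b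
isBlock⁻ m B∈ with i , eq ← ∈-tabulate⁻ B∈ = decode _ i , eq

-- `Q` has `weight m` ones and `weight m + 2 ^ m` zeros among the vectors of length `m * 2`.
2weight+2^ : ∀ m → 2 * weight m + 2 ^ m ≡ 2 ^ (m * 2)
2weight+2^ zero    = refl
2weight+2^ (suc m) = begin
  2 * (4 * weight m + 2 ^ m) + 2 * 2 ^ m
    ≡⟨ solve 2 (λ k w → con 2 :* (con 4 :* k :+ w) :+ con 2 :* w
                     := con 2 :* (con 2 :* (con 2 :* k :+ w))) refl (weight m) (2 ^ m) ⟩
  2 * (2 * (2 * weight m + 2 ^ m))  ≡⟨ cong (λ v → 2 * (2 * v)) (2weight+2^ m) ⟩
  2 ^ (suc m * 2)                   ∎
  where open ≡-Reasoning

0<weight : ∀ m → 0 < weight (suc m)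
0<weight m = ℕ.<-≤-trans (ℕ.m^n>0 2 m) (ℕ.m≤n+m _ (4 * weight m))

nontrivial : ∀ m → Nontrivial (design (suc m))
nontrivial m = record
  { 0<lam = ℕ.<-≤-trans (0<weight m) (ℕ.m≤m+n _ _)
  ; 2<k   = 2<k
  -- Blocks contain fewer than half of the points, so 1 + k < 2k < v once k exceeds 1.
  ; k<v-1 = begin-strict
      1 + k                    <⟨ ℕ.+-monoˡ-< k (ℕ.≤-trans (s≤s z<s) (ℕ.<⇒≤ 2<k)) ⟩
      k + k                    ≤⟨ ℕ.+-monoʳ-≤ k (ℕ.m≤m+n k 0) ⟩
      2 * k                    ≤⟨ ℕ.m≤m+n _ (2 ^ suc (suc m)) ⟩
      2 * k + 2 ^ suc (suc m)  ≡⟨ 2weight+2^ (suc (suc m)) ⟩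
      2 ^ (suc (suc m) * 2)    ∎
  }
  where
  open ℕ.≤-Reasoning
  k = weight (suc (suc m))
  2<k : 2 < k
  2<k = begin
    3                     ≤⟨ ℕ.n≤1+n 3 ⟩
    4 * 1                 ≤⟨ ℕ.*-monoʳ-≤ 4 (0<weight m) ⟩
    4 * weight (suc m)    ≤⟨ ℕ.m≤m+n _ (2 ^ suc m) ⟩
    k                     ∎

2^-injective : ∀ {m n} → 2 ^ m ≡ 2 ^ n → m ≡ n
2^-injective {m} {n} eq with ℕ.<-cmp m n
... | tri< m<n _ _ = contradiction eq (ℕ.<⇒≢ (ℕ.^-monoʳ-< 2 (s≤s z<s) m<n))
... | tri≈ _ m≡n _ = m≡n
... | tri> _ _ n<m = contradiction eq (ℕ.>⇒≢ (ℕ.^-monoʳ-< 2 (s≤s z<s) n<m))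

-- The number of points already separates the designs.
design-injective : ∀ {m n} → design m ≅ design n → m ≡ n
design-injective {m} {n} (π , _) =
  ℕ.suc-injective (ℕ.*-cancelʳ-≡ (suc m) (suc n) 2 (2^-injective (↔⇒≡ π)))

-- Translations

translate : ∀ {n} → Vec Bool n → Permutation′ (2 ^ n)
translate {n} a = permutation shift shift shift-shift shift-shift
  where
  shift : Fin (2 ^ n) → Fin (2 ^ n)
  shift x = encode (a ⊕ decode n x)
  shift-shift : ∀ x → shift (shift x) ≡ x
  shift-shift x = begin
    encode (a ⊕ decode n (encode (a ⊕ decode n x)))  ≡⟨ cong (encode ∘ (a ⊕_)) (decode-encode _) ⟩
    encode (a ⊕ (a ⊕ decode n x))                    ≡⟨ cong encode (⊕-cancelˡ a _) ⟩
    encode (decode n x)                              ≡⟨ encode-decode n x ⟩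
    x                                                ∎
    where open ≡-Reasoning

-- A pointwise condition rather than an equation with `translate a`, so that membership in the group
-- respects `≈`.
IsTranslation : ∀ {n} → Vec Bool n → Permutation′ (2 ^ n) → Set
IsTranslation {n} a h = ∀ x → decode n (h ⟨$⟩ʳ x) ≡ a ⊕ decode n x

-- In characteristic 2 every translation is its own inverse, hence the same vector `a`.
flip-isTranslation : ∀ {n} {a : Vec Bool n} h → IsTranslation a h → IsTranslation a (flip h)
flip-isTranslation {n} {a} h tr x = begin
  decode n (h ⟨$⟩ˡ x)                   ≡⟨ ⊕-cancelˡ a _ ⟨
  a ⊕ (a ⊕ decode n (h ⟨$⟩ˡ x))         ≡⟨ cong (a ⊕_) (tr (h ⟨$⟩ˡ x)) ⟨
  a ⊕ decode n (h ⟨$⟩ʳ (h ⟨$⟩ˡ x))      ≡⟨ cong (λ y → a ⊕ decode n y) (inverseʳ h) ⟩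
  a ⊕ decode n x                        ∎
  where open ≡-Reasoning

translations : ∀ n → PermutationGroup (2 ^ n)
translations n = record
  { Member    = λ h → ∃ λ a → IsTranslation a h
  ; respects  = λ g≈h (a , tr) → a , λ x → trans (cong (decode n) (sym (g≈h x))) (tr x)
  ; id-closed = replicate n false , λ x → sym (⊕-identityˡ (decode n x))
  -- `g ∘ₚ h` applies `g` first, so the vector of `h` ends up on the left.
  ; ∘-closed  = λ {g} {h} (a , tr) (b , tr′) → b ⊕ a , λ x →
      trans (tr′ (g ⟨$⟩ʳ x)) (trans (cong (b ⊕_) (tr x)) (sym (⊕-assoc b a (decode n x))))
  ; ⁻¹-closed = λ {g} (a , tr) → a , flip-isTranslation g tr
  }

-- Membership of `y` in the image is tested at its preimage `a ⊕ y`, and associativity moves `a`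
-- from the point to the shift of the block.
image-block : ∀ m {a} h → IsTranslation a h → ∀ b → image h (block m b) ≡ block m (b ⊕ a)
image-block m {a} h tr b = tabulate-cong λ y → begin
  lookup (block m b) (h ⟨$⟩ˡ y)          ≡⟨ lookup-block m b _ ⟩
  Q m (b ⊕ decode (m * 2) (h ⟨$⟩ˡ y))    ≡⟨ cong (λ z → Q m (b ⊕ z)) (flip-isTranslation h tr y) ⟩
  Q m (b ⊕ (a ⊕ decode (m * 2) y))       ≡⟨ cong (Q m) (⊕-assoc b a _) ⟨
  Q m ((b ⊕ a) ⊕ decode (m * 2) y)       ∎
  where open ≡-Reasoning

image-flip : ∀ {n} (π : Permutation′ n) B → image (flip π) (image π B) ≡ B
image-flip π B = trans
  (tabulate-cong λ y → trans (lookup∘tabulate _ (π ⟨$⟩ʳ y)) (cong (lookup B) (inverseˡ π)))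
  (tabulate∘lookup B)

translation-isAutomorphism : ∀ m {h} → Member (translations (suc m * 2)) h →
                             IsAutomorphism (design m) h
translation-isAutomorphism m {h} (a , tr) B = mk⇔ (preserve h tr) λ hB∈ →
  -- The converse is the forward direction for the inverse permutation, again a translation by `a`.
  subst (IsBlock (design m)) (image-flip h B) (preserve (flip h) (flip-isTranslation h tr) hB∈)
  where
  preserve : ∀ g → IsTranslation a g → ∀ {C} → IsBlock (design m) C → IsBlock (design m) (image g C)
  preserve g tr′ C∈ with b , refl ← isBlock⁻ m C∈ =
    subst (IsBlock (design m)) (sym (image-block (suc m) g tr′ b)) (isBlock m (b ⊕ a))

translations-blockTransitive : ∀ m → BlockTransitive (design m) (translations (suc m * 2))
translations-blockTransitive m B∈ C∈
  with b , refl ← isBlock⁻ m B∈ | c , refl ← isBlock⁻ m C∈ =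
  -- The shift `b` moves to `b ⊕ (b ⊕ c)`, which is `c`.
  translate (b ⊕ c) , (b ⊕ c , λ x → decode-encode _) ,
  trans (image-block (suc m) (translate (b ⊕ c)) (λ x → decode-encode _) b)
        (cong (block (suc m)) (⊕-cancelˡ b c))

-- Grids: s single bits, followed by one part holding the remaining suc n bits.

size : ∀ s → ℕ → Fin (suc s) → ℕ
size zero    n _       = suc n
size (suc s) n zero    = 1
size (suc s) n (suc i) = size s n i

0<size : ∀ s n i → 0 < size s n i
0<size zero    n _       = z<s
0<size (suc s) n zero    = z<s
0<size (suc s) n (suc i) = 0<size s n i

split : ∀ s {n} → Vec Bool (s + suc n) → (i : Fin (suc s)) → Vec Bool (size s n i)
split zero    x       _       = x
split (suc s) (b ∷ x) zero    = b ∷ []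
split (suc s) (b ∷ x) (suc i) = split s x i

join : ∀ s {n} → ((i : Fin (suc s)) → Vec Bool (size s n i)) → Vec Bool (s + suc n)
join zero    w = w zero
join (suc s) w = head (w zero) ∷ join s (w ∘ suc)

split-join : ∀ s {n} (w : (i : Fin (suc s)) → Vec Bool (size s n i)) i → split s (join s w) i ≡ w i
split-join zero    w zero    = refl
split-join (suc s) w zero    with b ∷ [] ← w zero = refl
split-join (suc s) w (suc i) = split-join s (w ∘ suc) i

split-injective : ∀ s {n} {x y : Vec Bool (s + suc n)} →
                  (∀ i → split s x i ≡ split s y i) → x ≡ y
split-injective zero    eq = eq zero
split-injective (suc s) {x = _ ∷ _} {_ ∷ _} eq =
  cong₂ _∷_ (∷-injectiveˡ (eq zero)) (split-injective s (eq ∘ suc))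

-- Additivity of the splitting is what makes translations act coordinatewise: on each part, `a` acts
-- as translation by its own part.
split-⊕ : ∀ s {n} (x y : Vec Bool (s + suc n)) i → split s (x ⊕ y) i ≡ split s x i ⊕ split s y i
split-⊕ zero    x       y       _       = refl
split-⊕ (suc s) (_ ∷ _) (_ ∷ _) zero    = refl
split-⊕ (suc s) (_ ∷ x) (_ ∷ y) (suc i) = split-⊕ s x y i

translations-gridImprimitive : ∀ s n →
  GridImprimitive (suc (suc s)) (translations (suc s + suc n))
translations-gridImprimitive s n = record
  { 2≤s        = s≤s z<s
  ; e          = λ i → 2 ^ size (suc s) n i
  ; 1<e        = λ i → ℕ.^-monoʳ-< 2 (s≤s z<s) (0<size (suc s) n i)
  ; grid       = grid
  ; bijective  =
      (λ eq → decode-injective N (split-injective (suc s) (encode-injective ∘ eq))) ,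
      -- Surjectivity is stated for every point equal to the chosen preimage; matching on `refl`
      -- reduces it to that preimage.
      λ ε → encode (join (suc s) (decode _ ∘ ε)) , λ { refl i → begin
        encode (split (suc s) (decode N (encode (join (suc s) (decode _ ∘ ε)))) i)
          ≡⟨ cong (λ x → encode (split (suc s) x i)) (decode-encode _) ⟩
        encode (split (suc s) (join (suc s) (decode _ ∘ ε)) i)
          ≡⟨ cong encode (split-join (suc s) (decode _ ∘ ε) i) ⟩
        encode (decode (size (suc s) n i) (ε i))
          ≡⟨ encode-decode (size (suc s) n i) (ε i) ⟩
        ε i ∎ }
  ; coordinate = λ {h} (a , tr) → (λ i → translate (split (suc s) a i)) , λ p i → begin
      encode (split (suc s) (decode N (h ⟨$⟩ʳ p)) i)
        ≡⟨ cong (λ x → encode (split (suc s) x i)) (tr p) ⟩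
      encode (split (suc s) (a ⊕ decode N p) i)
        ≡⟨ cong encode (split-⊕ (suc s) a (decode N p) i) ⟩
      encode (split (suc s) a i ⊕ split (suc s) (decode N p) i)
        ≡⟨ cong (λ x → encode (split (suc s) a i ⊕ x)) (decode-encode _) ⟨
      encode (split (suc s) a i ⊕ decode _ (grid p i)) ∎
  }
  where
  open ≡-Reasoning
  N = suc s + suc n
  grid : Fin (2 ^ N) → (i : Fin (suc (suc s))) → Fin (2 ^ size (suc s) n i)
  grid p i = encode (split (suc s) (decode N p) i)

-- Combining designs, translation groups and grids

blockTransitiveGridImprimitive : ∀ {s} m → GridImprimitive s (translations (suc m * 2)) →
                                 BlockTransitiveGridImprimitive s (design m)
blockTransitiveGridImprimitive m grid = record
  { H               = translations (suc m * 2)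
  ; automorphisms   = λ {h} → translation-isAutomorphism m {h}
  ; blockTransitive = translations-blockTransitive m
  ; gridImprimitive = grid
  }

theorem1p4 : InfinitelyMany (λ D → Nontrivial D × BlockTransitiveGridImprimitive 3 D)
    × ∃ (λ D → Nontrivial D × BlockTransitiveGridImprimitive 4 D)
theorem1p4 =
  -- `design 0` is skipped because its λ is 0.
  ( design ∘ suc
  , (λ iso → ℕ.suc-injective (design-injective iso))
  , λ m → nontrivial m ,
          -- The 2m + 4 bits split as 1 + 1 + (2m + 2), giving a grid of shape 2 × 2 × 4ᵐ⁺¹.
          blockTransitiveGridImprimitive (suc m) (translations-gridImprimitive 1 (suc (m * 2)))
  ) ,
  -- The 2-(16, 6, 2) design on four bits, each a part of its own: a 2 × 2 × 2 × 2 grid.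
  ( design 1
  , nontrivial 0
  , blockTransitiveGridImprimitive 1 (translations-gridImprimitive 2 0)
  )
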